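{- Let $a$ and $b$ be digits, and let $c,d$ be the integers with $0\le c,d\le 9$ and $a\times b=10c+d$. Then: (1) if $d\le 3$, then $(a,a)\bowtie b=c+d$; (2) if $d>3$, then $(a,a)\bowtie b=c+d-9$.
   Context: A digit is an element of $\{0,1,\dots,9\}$. For nonnegative integers $x,y$, let $u\in\{0,\dots,9\}$ be the ones digit of the usual product $x\times y$. The plum-blossom product $x\clubsuit y$ is defined by $x\clubsuit y=u$ if $u\le 3$, and $x\clubsuit y=u-10$ if $u>3$. The carry $J(x\clubsuit y)$ is the integer determined by $x\times y=10\,J(x\clubsuit y)+x\clubsuit y$; it depends on the pair $(x,y)$, not only on the value $x\clubsuit y$. For digits $a,b,c$, the plum-blossom wedge product of $(a,b)$ and $c$ is $(a,b)\bowtie c=a\clubsuit c+J(b\clubsuit c)$. -}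

module Defs where

open import Data.Bool.Base using (if_then_else_; true; false)
open import Data.Fin.Base using (Fin; toℕ)
open import Data.Integer.Base using (ℤ; +_; _+_; _*_; _-_; 1ℤ)
open import Data.Integer.Properties using (pos-+; pos-*; *-cancelˡ-≡; +-0-abelianGroup)
open import Data.Integer.Tactic.RingSolver using (solve-∀)
open import Data.Nat.Base as ℕ using (ℕ)
open import Data.Nat.DivMod using (_/_; _%_; m≡m%n+[m/n]*n)
open import Data.Product using (_×_; _,_; ∃; ∃!; proj₁)
open import Relation.Binary.PropositionalEquality
  using (_≡_; refl; sym; trans; cong; module ≡-Reasoning)
open import Algebra.Bundles using (AbelianGroup)
import Algebra.Properties.Group as GroupProperties

Digit : Set
Digit = Fin 10

onesDigit : ℕ → ℕ
onesDigit n = n % 10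

signedDigit : ℕ → ℤ
signedDigit u = if u ℕ.≤ᵇ 3 then + u else + u - + 10

infixl 7 _♣_ _⋈_

_♣_ : ℕ → ℕ → ℤ
x ♣ y = signedDigit (onesDigit (x ℕ.* y))

private
  module ℤ-Group = GroupProperties (AbelianGroup.group +-0-abelianGroup)

  division : ∀ n → + n ≡ + 10 * + (n / 10) + + (n % 10)
  division n = begin
    + n                                 ≡⟨ cong +_ (m≡m%n+[m/n]*n n 10) ⟩
    + (n % 10 ℕ.+ n / 10 ℕ.* 10)        ≡⟨ pos-+ (n % 10) (n / 10 ℕ.* 10) ⟩
    + (n % 10) + + (n / 10 ℕ.* 10)      ≡⟨ cong (λ i → + (n % 10) + i) (pos-* (n / 10) 10) ⟩
    + (n % 10) + + (n / 10) * + 10      ≡⟨ swap (+ (n % 10)) (+ (n / 10)) ⟩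
    + 10 * + (n / 10) + + (n % 10)      ∎
    where
    open ≡-Reasoning
    swap : ∀ r q → r + q * + 10 ≡ + 10 * q + r
    swap = solve-∀

  shift : ∀ q r → + 10 * q + r ≡ + 10 * (q + 1ℤ) + (r - + 10)
  shift = solve-∀

  signedDivision : ∀ q u → ∃ λ j → + 10 * + q + + u ≡ + 10 * j + signedDigit u
  signedDivision q u with u ℕ.≤ᵇ 3
  ... | true  = + q , refl
  ... | false = + q + 1ℤ , shift (+ q) (+ u)

  carry-unique : ∀ n r j k → n ≡ + 10 * j + r → n ≡ + 10 * k + r → j ≡ k
  carry-unique n r j k p q =
    *-cancelˡ-≡ (+ 10) j k (ℤ-Group.∙-cancelʳ r _ _ (trans (sym p) q))

carry : ∀ x y → ∃! _≡_ λ j → + (x ℕ.* y) ≡ + 10 * j + x ♣ y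
carry x y with signedDivision (x ℕ.* y / 10) (onesDigit (x ℕ.* y))
... | j , p = j , eq , λ {k} → carry-unique (+ (x ℕ.* y)) (x ♣ y) j k eq
  where eq = trans (division (x ℕ.* y)) p

-- The carry of x ♣ y; its arguments are the factors, since it is not a
-- function of the value x ♣ y.
J : ℕ → ℕ → ℤ
J x y = proj₁ (carry x y)

_⋈_ : Digit × Digit → Digit → ℤ
(a , b) ⋈ c = toℕ a ♣ toℕ c + J (toℕ b) (toℕ c)

{-# OPTIONS --safe #-}
module Submission where

open import Defs
open import Data.Fin.Base using (toℕ)
open import Data.Integer.Base using (ℤ; +_; _+_; _*_; _-_; _≤_; _>_; +≤+; +<+; 1ℤ)
open import Data.Integer.Properties using (+-injective; pos-+; pos-*; +-comm)
open import Data.Integer.Tactic.RingSolver using (solve-∀)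
open import Data.Nat.Base as ℕ using (ℕ; z≤n; s≤s)
import Data.Nat.Properties as ℕ
open import Data.Nat.DivMod using (_%_; [m+kn]%n≡m%n; m<n⇒m%n≡m)
open import Data.Product using (_×_; _,_; proj₂)
open import Relation.Binary.PropositionalEquality
  using (_≡_; refl; trans; cong; cong₂; module ≡-Reasoning)

open ≡-Reasoning

-- Since both entries of the pair are `a`, the wedge product adds the signed digit and the carry of
-- one product `a × b`. As `0 ≤ d ≤ 9`, `d` is its ones digit (`onesDigit-unique`). If `d ≤ 3`, the
-- signed digit is `d` and the carry `c`; otherwise they are `d - 10` and `c + 1`, whence the net
-- `- 9`. `J-unique` identifies the carry.

onesDigit-unique : ∀ n q {r} → r ℕ.< 10 → n ≡ 10 ℕ.* q ℕ.+ r → onesDigit n ≡ r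
onesDigit-unique n q {r} r<10 n≡10q+r = begin
  n % 10                  ≡⟨ cong (_% 10) n≡10q+r ⟩
  (10 ℕ.* q ℕ.+ r) % 10   ≡⟨ cong (_% 10) (ℕ.+-comm (10 ℕ.* q) r) ⟩
  (r ℕ.+ 10 ℕ.* q) % 10   ≡⟨ cong (λ k → (r ℕ.+ k) % 10) (ℕ.*-comm 10 q) ⟩
  (r ℕ.+ q ℕ.* 10) % 10   ≡⟨ [m+kn]%n≡m%n r q 10 ⟩
  r % 10                  ≡⟨ m<n⇒m%n≡m r<10 ⟩
  r                       ∎

-- Splitting the bound makes `u` a literal, so the test `u ≤ᵇ 3` evaluates.
signedDigit-≤3 : ∀ {u} → u ℕ.≤ 3 → signedDigit u ≡ + u
signedDigit-≤3 z≤n                   = refl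
signedDigit-≤3 (s≤s z≤n)             = refl
signedDigit-≤3 (s≤s (s≤s z≤n))       = refl
signedDigit-≤3 (s≤s (s≤s (s≤s z≤n))) = refl

signedDigit->3 : ∀ {u} → u ℕ.> 3 → signedDigit u ≡ + u - + 10
signedDigit->3 (s≤s (s≤s (s≤s (s≤s _)))) = refl

-- The uniqueness half of `carry`; `J` itself never has to be unfolded.
J-unique : ∀ x y j {r} → x ♣ y ≡ r → + (x ℕ.* y) ≡ + 10 * j + r → J x y ≡ j
J-unique x y j refl = proj₂ (proj₂ (carry x y))

-- For `(a , a)` the digit and the carry come from the same factors, so each case needs only one
-- decomposition of the product.
♣+J : ∀ x y j {r} → x ♣ y ≡ r → + (x ℕ.* y) ≡ + 10 * j + r → x ♣ y + J x y ≡ r + j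
♣+J x y j ♣≡r xy≡10j+r = cong₂ _+_ ♣≡r (J-unique x y j ♣≡r xy≡10j+r)

theorem2 : ∀ (a b : Digit) (c d : ℤ) →
    + 0 ≤ c → c ≤ + 9 →
    + 0 ≤ d → d ≤ + 9 →
    + toℕ a * + toℕ b ≡ + 10 * c + d →
    (d ≤ + 3 → (a , a) ⋈ b ≡ c + d) ×
    (d > + 3 → (a , a) ⋈ b ≡ c + d - + 9)
-- The lower bounds exclude negative `c` and `d`, leaving naturals `q` and `r`.
theorem2 a b (+ q) (+ r) _ _ _ (+≤+ r≤9) ab≡10q+r = case≤3 , case>3
  where
  x = toℕ a
  y = toℕ b

  xy≡10q+r : + (x ℕ.* y) ≡ + 10 * + q + + r
  xy≡10q+r = trans (pos-* x y) ab≡10q+r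

  ones≡r : onesDigit (x ℕ.* y) ≡ r
  -- The ones digit is defined on `ℕ`, so the integer equation is pulled back along the injection
  -- `+_`.
  ones≡r = onesDigit-unique (x ℕ.* y) q (s≤s r≤9) (+-injective (begin
    + (x ℕ.* y)              ≡⟨ xy≡10q+r ⟩
    + 10 * + q + + r         ≡⟨ cong (_+ + r) (pos-* 10 q) ⟨
    + (10 ℕ.* q) + + r       ≡⟨ pos-+ (10 ℕ.* q) r ⟨
    + (10 ℕ.* q ℕ.+ r)       ∎))

  case≤3 : + r ≤ + 3 → (a , a) ⋈ b ≡ + q + + r
  case≤3 (+≤+ r≤3) = trans
    (♣+J x y (+ q) (trans (cong signedDigit ones≡r) (signedDigit-≤3 r≤3)) xy≡10q+r)
    (+-comm (+ r) (+ q))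

  -- Subtracting 10 from the ones digit raises the carry from q to q + 1.
  case>3 : + r > + 3 → (a , a) ⋈ b ≡ + q + + r - + 9
  case>3 (+<+ r>3) = trans
    (♣+J x y (+ q + 1ℤ) (trans (cong signedDigit ones≡r) (signedDigit->3 r>3))
      (trans xy≡10q+r (borrow (+ q) (+ r))))
    (collect (+ q) (+ r))
    where
    borrow : ∀ i j → + 10 * i + j ≡ + 10 * (i + 1ℤ) + (j - + 10)
    borrow = solve-∀
    collect : ∀ i j → (j - + 10) + (i + 1ℤ) ≡ i + j - + 9
    collect = solve-∀
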